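{- Let $(I,+,\preceq_I,\ast)$ be a partially ordered commutative ring. Let $x_1,\dots,x_5\in I$ with $x_i\succeq_I x_{i+1}$ for $1\leq i\leq 4$ and $x_1+x_4\succeq_I x_2+x_3$, and let $n\geq 0$ be an integer. Let $a_1,\dots,a_5\in I$ and suppose that for each $i\in\{2,4\}$ there is an upper bound $\hat a_i\in I$ of $\{a_i,-a_i\}$ such that $a_1\succeq_I\hat a_2\succeq_I a_3\succeq_I 0$ and such that either $a_3+a_5\succeq_I\hat a_4\succeq_I a_5\succeq_I 0$ or $a_5\succeq_I\hat a_4\succeq_I 0$. Then $$\sum_{i=1}^5 a_i\ast\prod_{\substack{1\leq j\leq 5\\ j\neq i}}(x_i-x_j)^n\succeq_I 0,$$ where the product is taken with respect to $\ast$.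
   Context: A partially ordered Abelian group $(I,+,\preceq_I)$ is an Abelian group with a partial order such that $x+z\preceq_I y+z\Leftrightarrow x\preceq_I y$ for all $x,y,z\in I$. A partially ordered commutative ring $(I,+,\preceq_I,\ast)$ is a partially ordered Abelian group together with an operation $\ast:I\times I\to I$ that is associative, commutative, distributive over $+$, nonnegativity-preserving ($x\succeq_I 0$ and $y\succeq_I 0$ imply $x\ast y\succeq_I 0$), and has an identity element in $I$. Powers $x^n$ are with respect to $\ast$. An element $u$ is an upper bound of $S\subset I$ if $u\succeq_I s$ for all $s\in S$. -}

module Defs where

open import Algebra.Bundles using (CommutativeRing; Semiring)
open import Algebra.Core using (Op₁; Op₂)
open import Algebra.Structures using (IsCommutativeRing)
import Algebra.Definitions.RawSemiring as RawSemiringDefinitions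
open import Data.Fin.Base using (Fin)
open import Data.Nat.Base using (ℕ; suc)
open import Data.Sum.Base using (_⊎_)
open import Data.Vec.Functional using (Vector; removeAt)
open import Function.Bundles using (_⇔_)
open import Level using (Level; _⊔_) renaming (suc to lsuc)
open import Relation.Binary.Bundles using (Poset)
open import Relation.Binary.Core using (Rel)
open import Relation.Binary.Structures using (IsPartialOrder)
open import Relation.Unary using (Pred)

-- The order is not required to be decidable or total, and no compatibility
-- of 1# with it (such as 0# ≤ 1#) is assumed.
record PartiallyOrderedCommutativeRing (c ℓ₁ ℓ₂ : Level) : Set (lsuc (c ⊔ ℓ₁ ⊔ ℓ₂)) where
  infix  8 -_
  infixl 7 _*_
  infixl 6 _+_
  infix  4 _≈_ _≤_
  field
    Carrier           : Set c
    _≈_               : Rel Carrier ℓ₁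
    _≤_               : Rel Carrier ℓ₂
    _+_               : Op₂ Carrier
    _*_               : Op₂ Carrier
    -_                : Op₁ Carrier
    0#                : Carrier
    1#                : Carrier
    isCommutativeRing : IsCommutativeRing _≈_ _+_ _*_ -_ 0# 1#
    isPartialOrder    : IsPartialOrder _≈_ _≤_
    +-translation     : ∀ x y z → (x + z ≤ y + z) ⇔ (x ≤ y)
    *-nonNegative     : ∀ x y → 0# ≤ x → 0# ≤ y → 0# ≤ x * y

  commutativeRing : CommutativeRing c ℓ₁
  commutativeRing = record { isCommutativeRing = isCommutativeRing }

  open CommutativeRing commutativeRing public using (_-_; semiring)

  poset : Poset c ℓ₁ ℓ₂
  poset = record { isPartialOrder = isPartialOrder }

  open Poset poset public using (_≥_)

  open RawSemiringDefinitions (Semiring.rawSemiring semiring) public using (_^_; sum; product)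

  IsUpperBound : ∀ {p} → Pred Carrier p → Carrier → Set (c ⊔ ℓ₂ ⊔ p)
  IsUpperBound S u = ∀ s → S s → u ≥ s

  ｛_,_｝ : Carrier → Carrier → Pred Carrier ℓ₁
  ｛ a , b ｝ s = s ≈ a ⊎ s ≈ b

  -- removeAt x i lists the entries x j with j ≠ i, so this is the product
  -- of (x i - x j) ^ n over all j ≠ i.
  ∏-differences : ∀ {m} → Vector Carrier (suc m) → ℕ → Fin (suc m) → Carrier
  ∏-differences x n i = product (λ j → (x i - removeAt x i j) ^ n)

{-# OPTIONS --safe #-}

-- Write the gaps between consecutive xᵢ as t + r, q, r, s ≥ 0; the hypothesis
-- x₁ + x₄ ≥ x₂ + x₃ says that the first gap is the third one plus some t ≥ 0.
-- Up to sign, ∏ⱼ (xᵢ - xⱼ) is then a polynomial bᵢ in q, r, s, t with natural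
-- coefficients, and all comparisons between the bᵢ hold coefficientwise.
-- Estimating a₂ and a₄ by their bounds reduces the claim to b₁ ≥ b₂ and b₅ ≥ b₄
-- in the one case, and in the other also to b₁ⁿ + b₃ⁿ ≥ b₂ⁿ + b₄ⁿ, which follows
-- by induction on n from b₁ + b₃ ≥ b₂ + b₄, b₁ ≥ b₂ ≥ b₃ and b₁ ≥ b₄.
module Submission where

open import Defs
open import Algebra.Bundles using (CommutativeRing)
import Algebra.Properties.CommutativeSemiring.Exp as Exp
import Algebra.Properties.Ring as RingProperties
import Algebra.Solver.Ring.NaturalCoefficients.Default as SemiringSolver
open import Data.Fin.Base using (Fin; suc; inject₁)
open import Data.Fin.Patterns using (0F; 1F; 2F; 3F; 4F)
open import Data.Nat.Base using (ℕ; zero; suc)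
open import Data.Product.Base using (∃-syntax; _×_; _,_)
open import Data.Sum.Base using (_⊎_; inj₁; inj₂)
open import Data.Vec.Functional using (Vector; head; tail; removeAt)
open import Function.Bundles using (Equivalence)
import Relation.Binary.Reasoning.PartialOrder as PosetReasoning
import Relation.Binary.Reasoning.Setoid as SetoidReasoning
open import Relation.Binary.Structures using (module IsPartialOrder)

module OrderedRingProperties
  {c ℓ₁ ℓ₂} (I : PartiallyOrderedCommutativeRing c ℓ₁ ℓ₂) where

  open PartiallyOrderedCommutativeRing I
  open CommutativeRing commutativeRing
    using ( setoid; refl; sym; trans; ring; commutativeSemiring
          ; +-cong; +-congˡ; +-congʳ; +-comm; +-assoc; +-identityˡ; +-identityʳ
          ; -‿cong; -‿inverseʳ; *-cong; *-congˡ; *-congʳ; *-comm; *-identityʳ; distribʳ; zeroˡ)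
  open RingProperties ring
    using ( -‿distribˡ-*; -‿distribʳ-*; -‿involutive; ⁻¹-anti-homo‿-
          ; //-rightDividesˡ)
  open Exp commutativeSemiring using (^-congˡ; ^-distrib-*)
  open SemiringSolver commutativeSemiring using (solve; _:+_; _:*_; _:=_)
  open IsPartialOrder isPartialOrder using (≤-respʳ-≈; ≤-respˡ-≈)
    renaming (refl to ≤-refl; trans to ≤-trans)

  private
    variable
      a b d e x y z w u v : Carrier

  -- Arithmetic of the order.

  +-monoˡ-≤ : ∀ z → x ≤ y → x + z ≤ y + z
  +-monoˡ-≤ z = Equivalence.from (+-translation _ _ z)

  +-cancelʳ-≤ : ∀ z → x + z ≤ y + z → x ≤ y
  +-cancelʳ-≤ z = Equivalence.to (+-translation _ _ z)

  +-mono-≤ : x ≤ y → z ≤ w → x + z ≤ y + w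
  +-mono-≤ {x} {y} {z} {w} x≤y z≤w = begin
    x + z  ≤⟨ +-monoˡ-≤ z x≤y ⟩
    y + z  ≈⟨ +-comm y z ⟩
    z + y  ≤⟨ +-monoˡ-≤ y z≤w ⟩
    w + y  ≈⟨ +-comm w y ⟩
    y + w  ∎
    where open PosetReasoning poset

  infixl 6 _+⁺_
  _+⁺_ : 0# ≤ x → 0# ≤ y → 0# ≤ x + y
  0≤x +⁺ 0≤y = ≤-respˡ-≈ (+-identityˡ 0#) (+-mono-≤ 0≤x 0≤y)

  infixl 7 _*⁺_
  _*⁺_ : 0# ≤ x → 0# ≤ y → 0# ≤ x * y
  _*⁺_ = *-nonNegative _ _

  ≈+⇒≤ : y ≈ x + d → 0# ≤ d → x ≤ y
  ≈+⇒≤ {y} {x} {d} y≈x+d 0≤d = begin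
    x       ≈⟨ +-identityʳ x ⟨
    x + 0#  ≤⟨ +-mono-≤ ≤-refl 0≤d ⟩
    x + d   ≈⟨ y≈x+d ⟨
    y       ∎
    where open PosetReasoning poset

  ≤⇒0≤- : x ≤ y → 0# ≤ y - x
  ≤⇒0≤- {x} {y} x≤y = ≤-respˡ-≈ (-‿inverseʳ x) (+-monoˡ-≤ (- x) x≤y)

  -- Trades an inequality for an equation with a nonnegative remainder. Inequalities between
  -- products thus become identities without subtraction, which the semiring solver can check.
  ≤⇒≈+ : x ≤ y → ∃[ d ] 0# ≤ d × y ≈ x + d
  ≤⇒≈+ {x} {y} x≤y =
    y - x , ≤⇒0≤- x≤y , sym (trans (+-comm x (y - x)) (//-rightDividesˡ x y))

  *-monoʳ-≤ : 0# ≤ z → x ≤ y → z * x ≤ z * y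
  *-monoʳ-≤ {z} {x} 0≤z x≤y with d , 0≤d , y≈x+d ← ≤⇒≈+ x≤y =
    ≈+⇒≤ (trans (*-congˡ y≈x+d) (solve 3 (λ z x d → z :* (x :+ d) := z :* x :+ z :* d) refl z x d))
         (0≤z *⁺ 0≤d)

  -- The comparison passes through `x * w`, hence the sign conditions on these two factors.
  *-mono-≤ : 0# ≤ x → 0# ≤ w → x ≤ y → z ≤ w → x * z ≤ y * w
  *-mono-≤ {x} {w} {y} {z} 0≤x 0≤w x≤y z≤w = begin
    x * z  ≤⟨ *-monoʳ-≤ 0≤x z≤w ⟩
    x * w  ≈⟨ *-comm x w ⟩
    w * x  ≤⟨ *-monoʳ-≤ 0≤w x≤y ⟩
    w * y  ≈⟨ *-comm w y ⟩
    y * w  ∎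
    where open PosetReasoning poset

  -- The two sides differ by `(y - x) * (w - z)`, a product of nonnegative factors.
  rearrangement : x ≤ y → z ≤ w → x * w + y * z ≤ x * z + y * w
  rearrangement {x} {y} {z} {w} x≤y z≤w
    with d , 0≤d , y≈x+d ← ≤⇒≈+ x≤y | e , 0≤e , w≈z+e ← ≤⇒≈+ z≤w =
    ≈+⇒≤ (begin
      x * z + y * w                              ≈⟨ +-congˡ (*-cong y≈x+d w≈z+e) ⟩
      x * z + (x + d) * (z + e)                  ≈⟨ solve 4 (λ x z d e →
        x :* z :+ (x :+ d) :* (z :+ e) := (x :* (z :+ e) :+ (x :+ d) :* z) :+ d :* e) refl x z d e ⟩
      (x * (z + e) + (x + d) * z) + d * e        ≈⟨ +-congʳ (+-cong (*-congˡ w≈z+e) (*-congʳ y≈x+d)) ⟨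
      (x * w + y * z) + d * e                    ∎)
      (0≤d *⁺ 0≤e)
    where open SetoidReasoning setoid

  -- Inequalities between powers.

  -- x ^ 0 = 1# need not be nonnegative, so powers are only handled as factors.
  *^-nonNegative : 0# ≤ a → 0# ≤ x → ∀ n → 0# ≤ a * x ^ n
  *^-nonNegative {a} 0≤a 0≤x zero = ≤-respʳ-≈ (sym (*-identityʳ a)) 0≤a
  *^-nonNegative {a} {x} 0≤a 0≤x (suc n) =
    ≤-respʳ-≈ (solve 3 (λ a x y → x :* (a :* y) := a :* (x :* y)) refl a x (x ^ n))
      (0≤x *⁺ *^-nonNegative 0≤a 0≤x n)

  *^-monoˡ-≤ : 0# ≤ x → a ≤ b → ∀ n → a * x ^ n ≤ b * x ^ n
  *^-monoˡ-≤ {x} {a} 0≤x a≤b n with d , 0≤d , b≈a+d ← ≤⇒≈+ a≤b =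
    ≈+⇒≤ (trans (*-congʳ b≈a+d) (distribʳ (x ^ n) a d)) (*^-nonNegative 0≤d 0≤x n)

  -- In the step, `(y - x) * x ^ n` is nonnegative even if `x ^ n` is not, as may happen at `n = 0`;
  -- the first comparison therefore goes through `*^-monoˡ-≤`.
  ^-mono-≤ : 0# ≤ x → x ≤ y → ∀ n → x ^ n ≤ y ^ n
  ^-mono-≤ 0≤x x≤y zero    = ≤-refl
  ^-mono-≤ 0≤x x≤y (suc n) =
    ≤-trans (*^-monoˡ-≤ 0≤x x≤y n) (*-monoʳ-≤ (≤-trans 0≤x x≤y) (^-mono-≤ 0≤x x≤y n))

  -- Induction step, with U, V, W, Z the n-th powers of u, v, w, z:
  -- uU - vV - wW + zZ = w(U - V - W + Z) + (u - w)(U - V) + (u - v)(V - Z) + (u - v - w + z)Z.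
  ^-sum-mono : 0# ≤ z → z ≤ v → v ≤ u → 0# ≤ w → w ≤ u → v + w ≤ u + z →
               ∀ n → v ^ n + w ^ n ≤ u ^ n + z ^ n
  ^-sum-mono 0≤z z≤v v≤u 0≤w w≤u v+w≤u+z zero = ≤-refl
  ^-sum-mono {z} {v} {u} {w} 0≤z z≤v v≤u 0≤w w≤u v+w≤u+z (suc n) =
    -- The six added terms are those that cancel when the right side of the identity above is
    -- expanded; with them on both sides no subtraction is left.
    +-cancelʳ-≤ (w * V + w * U + u * V + v * Z + u * Z + w * Z) (begin
      v * V + w * W + (w * V + w * U + u * V + v * Z + u * Z + w * Z)
        ≈⟨ solve 8 (λ u v w z U V W Z →
             v :* V :+ w :* W :+ (w :* V :+ w :* U :+ u :* V :+ v :* Z :+ u :* Z :+ w :* Z) :=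
             (w :* (V :+ W) :+ (w :* U :+ u :* V)) :+ ((v :* V :+ u :* Z) :+ (v :+ w) :* Z))
             refl u v w z U V W Z ⟩
      (w * (V + W) + (w * U + u * V)) + ((v * V + u * Z) + (v + w) * Z)
        ≤⟨ +-mono-≤
             (+-mono-≤ (*-monoʳ-≤ 0≤w (^-sum-mono 0≤z z≤v v≤u 0≤w w≤u v+w≤u+z n))
                       (rearrangement w≤u (^-mono-≤ (≤-trans 0≤z z≤v) v≤u n)))
             (+-mono-≤ (rearrangement v≤u (^-mono-≤ 0≤z z≤v n))
                       (*^-monoˡ-≤ 0≤z v+w≤u+z n)) ⟩
      (w * (U + Z) + (w * V + u * U)) + ((v * Z + u * V) + (u + z) * Z)
        ≈⟨ solve 7 (λ u v w z U V Z →
             (w :* (U :+ Z) :+ (w :* V :+ u :* U)) :+ ((v :* Z :+ u :* V) :+ (u :+ z) :* Z) :=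
             u :* U :+ z :* Z :+ (w :* V :+ w :* U :+ u :* V :+ v :* Z :+ u :* Z :+ w :* Z))
             refl u v w z U V Z ⟩
      u * U + z * Z + (w * V + w * U + u * V + v * Z + u * Z + w * Z) ∎)
    where
    open PosetReasoning poset
    U = u ^ n
    V = v ^ n
    W = w ^ n
    Z = z ^ n

  -- Powers of products and of negatives.

  1^n≈1 : ∀ n → 1# ^ n ≈ 1#
  1^n≈1 zero    = refl
  1^n≈1 (suc n) = trans (*-congˡ (1^n≈1 n)) (*-identityʳ 1#)

  product-^ : ∀ {m} (f : Vector Carrier m) n → product (λ j → f j ^ n) ≈ product f ^ n
  product-^ {zero}  f n = sym (1^n≈1 n)
  product-^ {suc m} f n =
    trans (*-congˡ (product-^ (tail f) n)) (sym (^-distrib-* (head f) (product (tail f)) n))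

  -x*-y≈x*y : ∀ x y → - x * - y ≈ x * y
  -x*-y≈x*y x y = begin
    - x * - y      ≈⟨ -‿distribˡ-* x (- y) ⟨
    - (x * - y)    ≈⟨ -‿distribʳ-* x (- y) ⟩
    x * - (- y)    ≈⟨ *-congˡ (-‿involutive y) ⟩
    x * y          ∎
    where open SetoidReasoning setoid

  -- Only the resulting sign matters later, so the parity of `n` is recorded as this dichotomy.
  -^-sign : ∀ x n → (- x) ^ n ≈ x ^ n ⊎ (- x) ^ n ≈ - (x ^ n)
  -^-sign x zero = inj₁ refl
  -^-sign x (suc n) with -^-sign x n
  ... | inj₁ even = inj₂ (trans (*-congˡ even) (sym (-‿distribˡ-* x (x ^ n))))
  ... | inj₂ odd  = inj₁ (trans (*-congˡ odd) (-x*-y≈x*y x (x ^ n)))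

  -- Depending on the sign of `(- d) ^ n`, the sum is `(a + b) * d ^ n` or `(- a + b) * d ^ n`, and
  -- `b` bounds both `- a` and `a`.
  abs-bound : ∀ n → IsUpperBound ｛ a , - a ｝ b → 0# ≤ d → y ≈ (- d) ^ n →
              0# ≤ a * y + b * d ^ n
  abs-bound {a} {b} {d} {y} n a≤b 0≤d y≈[-d]^n with -^-sign d n
  ... | inj₁ even = begin
    0#                       ≈⟨ zeroˡ (d ^ n) ⟨
    0# * d ^ n               ≤⟨ *^-monoˡ-≤ 0≤d 0≤a+b n ⟩
    (a + b) * d ^ n          ≈⟨ distribʳ (d ^ n) a b ⟩
    a * d ^ n + b * d ^ n    ≈⟨ +-congʳ (*-congˡ (trans y≈[-d]^n even)) ⟨
    a * y + b * d ^ n        ∎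
    where
    open PosetReasoning poset
    0≤a+b : 0# ≤ a + b
    0≤a+b = ≤-respˡ-≈ (-‿inverseʳ a) (+-mono-≤ ≤-refl (a≤b (- a) (inj₂ refl)))
  ... | inj₂ odd = begin
    0#                          ≈⟨ zeroˡ (d ^ n) ⟨
    0# * d ^ n                  ≤⟨ *^-monoˡ-≤ 0≤d 0≤-a+b n ⟩
    (- a + b) * d ^ n           ≈⟨ distribʳ (d ^ n) (- a) b ⟩
    - a * d ^ n + b * d ^ n     ≈⟨ +-congʳ (trans (sym (-‿distribˡ-* a (d ^ n))) (-‿distribʳ-* a (d ^ n))) ⟩
    a * - (d ^ n) + b * d ^ n   ≈⟨ +-congʳ (*-congˡ (trans y≈[-d]^n odd)) ⟨
    a * y + b * d ^ n           ∎
    where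
    open PosetReasoning poset
    0≤-a+b : 0# ≤ - a + b
    0≤-a+b = ≤-respʳ-≈ (+-comm b (- a)) (≤⇒0≤- (a≤b a (inj₁ refl)))

  -- The inequality for abstract values with alternating signs.

  signed-sum-nonNegative :
    ∀ {a₁ a₂ a₃ a₄ a₅ â₂ â₄ b₁ b₂ b₃ b₄ b₅ y₁ y₂ y₃ y₄ y₅ : Carrier} n →
    IsUpperBound ｛ a₂ , - a₂ ｝ â₂ → IsUpperBound ｛ a₄ , - a₄ ｝ â₄ →
    â₂ ≤ a₁ → a₃ ≤ â₂ → 0# ≤ a₃ →
    (â₄ ≤ a₃ + a₅ × a₅ ≤ â₄ × 0# ≤ a₅) ⊎ (â₄ ≤ a₅ × 0# ≤ â₄) →
    0# ≤ b₃ → b₃ ≤ b₂ → b₂ ≤ b₁ → 0# ≤ b₄ → b₄ ≤ b₁ → b₂ + b₄ ≤ b₁ + b₃ → b₄ ≤ b₅ →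
    y₁ ≈ b₁ ^ n → y₂ ≈ (- b₂) ^ n → y₃ ≈ b₃ ^ n → y₄ ≈ (- b₄) ^ n → y₅ ≈ b₅ ^ n →
    0# ≤ a₁ * y₁ + (a₂ * y₂ + (a₃ * y₃ + (a₄ * y₄ + (a₅ * y₅ + 0#))))
  signed-sum-nonNegative {a₁} {a₂} {a₃} {a₄} {a₅} {â₂} {â₄} {b₁} {b₂} {b₃} {b₄} {b₅}
    {y₁} {y₂} {y₃} {y₄} {y₅} n ∣a₂∣≤â₂ ∣a₄∣≤â₄ â₂≤a₁ a₃≤â₂ 0≤a₃ cases
    0≤b₃ b₃≤b₂ b₂≤b₁ 0≤b₄ b₄≤b₁ b₂+b₄≤b₁+b₃ b₄≤b₅ y₁≈ y₂≈ y₃≈ y₄≈ y₅≈ =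
    -- Adding these two terms completes `a₂ * y₂` and `a₄ * y₄` to the nonnegative sums of
    -- `abs-bound`; the rest of the sum must then dominate them, which is `bound`.
    +-cancelʳ-≤ (â₂ * B₂ + â₄ * B₄) (begin
      0# + (â₂ * B₂ + â₄ * B₄)
        ≤⟨ +-mono-≤ (abs-bound n ∣a₂∣≤â₂ 0≤b₂ y₂≈ +⁺ abs-bound n ∣a₄∣≤â₄ 0≤b₄ y₄≈)
                    (bound cases) ⟩
      ((a₂ * y₂ + â₂ * B₂) + (a₄ * y₄ + â₄ * B₄)) + (a₁ * B₁ + a₃ * B₃ + a₅ * B₅)
        ≈⟨ +-congˡ (+-cong (+-cong (*-congˡ y₁≈) (*-congˡ y₃≈)) (*-congˡ y₅≈)) ⟨
      ((a₂ * y₂ + â₂ * B₂) + (a₄ * y₄ + â₄ * B₄)) + (a₁ * y₁ + a₃ * y₃ + a₅ * y₅)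
        ≈⟨ solve 7 (λ s₁ s₂ s₃ s₄ s₅ s₆ s₇ →
             ((s₂ :+ s₆) :+ (s₄ :+ s₇)) :+ (s₁ :+ s₃ :+ s₅) :=
             (s₁ :+ (s₂ :+ (s₃ :+ (s₄ :+ s₅)))) :+ (s₆ :+ s₇))
             refl (a₁ * y₁) (a₂ * y₂) (a₃ * y₃) (a₄ * y₄) (a₅ * y₅) (â₂ * B₂) (â₄ * B₄) ⟩
      (a₁ * y₁ + (a₂ * y₂ + (a₃ * y₃ + (a₄ * y₄ + a₅ * y₅)))) + (â₂ * B₂ + â₄ * B₄)
        -- The innermost `0#` is the empty sum left by unfolding `sum`.
        ≈⟨ +-congʳ (+-congˡ (+-congˡ (+-congˡ (+-congˡ (+-identityʳ (a₅ * y₅)))))) ⟨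
      (a₁ * y₁ + (a₂ * y₂ + (a₃ * y₃ + (a₄ * y₄ + (a₅ * y₅ + 0#))))) + (â₂ * B₂ + â₄ * B₄) ∎)
    where
    open PosetReasoning poset
    B₁ = b₁ ^ n
    B₂ = b₂ ^ n
    B₃ = b₃ ^ n
    B₄ = b₄ ^ n
    B₅ = b₅ ^ n

    0≤b₂ : 0# ≤ b₂
    0≤b₂ = ≤-trans 0≤b₃ b₃≤b₂

    0≤b₁ : 0# ≤ b₁
    0≤b₁ = ≤-trans 0≤b₂ b₂≤b₁

    B₂≤B₁ : B₂ ≤ B₁
    B₂≤B₁ = ^-mono-≤ 0≤b₂ b₂≤b₁ n

    B₄≤B₅ : B₄ ≤ B₅
    B₄≤B₅ = ^-mono-≤ 0≤b₄ b₄≤b₅ n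

    â₂B₁≤a₁B₁ : â₂ * B₁ ≤ a₁ * B₁
    â₂B₁≤a₁B₁ = *^-monoˡ-≤ 0≤b₁ â₂≤a₁ n

    bound : (â₄ ≤ a₃ + a₅ × a₅ ≤ â₄ × 0# ≤ a₅) ⊎ (â₄ ≤ a₅ × 0# ≤ â₄) →
            â₂ * B₂ + â₄ * B₄ ≤ a₁ * B₁ + a₃ * B₃ + a₅ * B₅
    -- The right side minus the left is `(a₁ - â₂) * B₁ + (â₂ - a₃) * (B₁ - B₂) + a₃ * (B₁ - B₂ + B₃
    -- - B₄) + a₅ * (B₅ - B₄) + (a₃ + a₅ - â₄) * B₄`, with every summand nonnegative. The cancelled
    -- terms again avoid subtraction.
    bound (inj₁ (â₄≤a₃+a₅ , a₅≤â₄ , 0≤a₅)) =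
      +-cancelʳ-≤ (a₃ * B₁ + a₃ * B₂ + â₂ * B₁) (begin
        â₂ * B₂ + â₄ * B₄ + (a₃ * B₁ + a₃ * B₂ + â₂ * B₁)
          ≤⟨ +-mono-≤ (+-mono-≤ ≤-refl (*^-monoˡ-≤ 0≤b₄ â₄≤a₃+a₅ n)) ≤-refl ⟩
        â₂ * B₂ + (a₃ + a₅) * B₄ + (a₃ * B₁ + a₃ * B₂ + â₂ * B₁)
          ≈⟨ solve 6 (λ â₂ a₃ a₅ B₁ B₂ B₄ →
               â₂ :* B₂ :+ (a₃ :+ a₅) :* B₄ :+ (a₃ :* B₁ :+ a₃ :* B₂ :+ â₂ :* B₁) :=
               ((a₃ :* B₁ :+ â₂ :* B₂) :+ a₃ :* (B₂ :+ B₄)) :+ (â₂ :* B₁ :+ a₅ :* B₄))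
               refl â₂ a₃ a₅ B₁ B₂ B₄ ⟩
        ((a₃ * B₁ + â₂ * B₂) + a₃ * (B₂ + B₄)) + (â₂ * B₁ + a₅ * B₄)
          ≤⟨ +-mono-≤
               (+-mono-≤ (rearrangement a₃≤â₂ B₂≤B₁)
                 (*-monoʳ-≤ 0≤a₃ (^-sum-mono 0≤b₃ b₃≤b₂ b₂≤b₁ 0≤b₄ b₄≤b₁ b₂+b₄≤b₁+b₃ n)))
               (+-mono-≤ â₂B₁≤a₁B₁ (*-monoʳ-≤ 0≤a₅ B₄≤B₅)) ⟩
        ((a₃ * B₂ + â₂ * B₁) + a₃ * (B₁ + B₃)) + (a₁ * B₁ + a₅ * B₅)
          ≈⟨ solve 8 (λ a₁ â₂ a₃ a₅ B₁ B₂ B₃ B₅ →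
               ((a₃ :* B₂ :+ â₂ :* B₁) :+ a₃ :* (B₁ :+ B₃)) :+ (a₁ :* B₁ :+ a₅ :* B₅) :=
               a₁ :* B₁ :+ a₃ :* B₃ :+ a₅ :* B₅ :+ (a₃ :* B₁ :+ a₃ :* B₂ :+ â₂ :* B₁))
               refl a₁ â₂ a₃ a₅ B₁ B₂ B₃ B₅ ⟩
        a₁ * B₁ + a₃ * B₃ + a₅ * B₅ + (a₃ * B₁ + a₃ * B₂ + â₂ * B₁) ∎)
    bound (inj₂ (â₄≤a₅ , 0≤â₄)) = begin
      â₂ * B₂ + â₄ * B₄
        ≤⟨ +-mono-≤ (≤-trans (*-monoʳ-≤ (≤-trans 0≤a₃ a₃≤â₂) B₂≤B₁) â₂B₁≤a₁B₁)
             (≤-trans (*-monoʳ-≤ 0≤â₄ B₄≤B₅) (*^-monoˡ-≤ (≤-trans 0≤b₄ b₄≤b₅) â₄≤a₅ n)) ⟩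
      a₁ * B₁ + a₅ * B₅
        ≤⟨ +-mono-≤ (≈+⇒≤ refl (*^-nonNegative 0≤a₃ 0≤b₃ n)) ≤-refl ⟩
      a₁ * B₁ + a₃ * B₃ + a₅ * B₅ ∎

  -- Comparisons between the gap polynomials.

  -- The absolute values of the products of differences of five points with
  -- consecutive gaps t + r, q, r, s.
  module GapPolynomials {q r s t : Carrier}
    (0≤q : 0# ≤ q) (0≤r : 0# ≤ r) (0≤s : 0# ≤ s) (0≤t : 0# ≤ t) where

    p b₁ b₂ b₃ b₄ b₅ : Carrier
    p  = t + r
    b₁ = p * ((p + q) * ((p + (q + r)) * (p + (q + (r + s)))))
    b₂ = p * (q * ((q + r) * (q + (r + s))))
    b₃ = (p + q) * (q * (r * (r + s)))
    b₄ = (p + (q + r)) * ((q + r) * (r * s))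
    b₅ = (p + (q + (r + s))) * ((q + (r + s)) * ((r + s) * s))

    0≤p : 0# ≤ p
    0≤p = 0≤t +⁺ 0≤r

    0≤b₃ : 0# ≤ b₃
    0≤b₃ = (0≤p +⁺ 0≤q) *⁺ (0≤q *⁺ (0≤r *⁺ (0≤r +⁺ 0≤s)))

    0≤b₄ : 0# ≤ b₄
    0≤b₄ = (0≤p +⁺ (0≤q +⁺ 0≤r)) *⁺ ((0≤q +⁺ 0≤r) *⁺ (0≤r *⁺ 0≤s))

    y≤x+y : 0# ≤ x → y ≤ x + y
    y≤x+y {x} {y} 0≤x = ≈+⇒≤ (+-comm x y) 0≤x

    b₂≤b₁ : b₂ ≤ b₁
    b₂≤b₁ = *-monoʳ-≤ 0≤p
      (*-mono-≤ 0≤q ((0≤p +⁺ (0≤q +⁺ 0≤r)) *⁺ (0≤p +⁺ (0≤q +⁺ (0≤r +⁺ 0≤s)))) (y≤x+y 0≤p)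
        (*-mono-≤ (0≤q +⁺ 0≤r) (0≤p +⁺ (0≤q +⁺ (0≤r +⁺ 0≤s))) (y≤x+y 0≤p) (y≤x+y 0≤p)))

    -- Since `p = t + r`, `p * (q + r)` equals `(p + q) * r + t * q`; substituting this in `b₂`
    -- leaves the remainder shown.
    b₃≤b₂ : b₃ ≤ b₂
    b₃≤b₂ = ≈+⇒≤
      (solve 4 (λ q r s t →
         (t :+ r) :* (q :* ((q :+ r) :* (q :+ (r :+ s)))) :=
         (t :+ r :+ q) :* (q :* (r :* (r :+ s)))
         :+ q :* ((t :+ r :+ q) :* (r :* q) :+ t :* (q :* (q :+ (r :+ s)))))
         refl q r s t)
      (0≤q *⁺ ((0≤p +⁺ 0≤q) *⁺ (0≤r *⁺ 0≤q) +⁺ 0≤t *⁺ (0≤q *⁺ (0≤q +⁺ (0≤r +⁺ 0≤s)))))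

    -- After reordering, the factors compare one by one: `r ≤ p` and `q + r ≤ p + q` because
    -- `p = t + r`, and `s` is at most the sum of all gaps.
    b₄≤b₁ : b₄ ≤ b₁
    b₄≤b₁ = begin
      (p + (q + r)) * ((q + r) * (r * s))
        ≈⟨ solve 4 (λ y z r s → y :* (z :* (r :* s)) := r :* (z :* (y :* s)))
             refl (p + (q + r)) (q + r) r s ⟩
      r * ((q + r) * ((p + (q + r)) * s))
        ≤⟨ *-mono-≤ 0≤r ((0≤p +⁺ 0≤q) *⁺ ((0≤p +⁺ (0≤q +⁺ 0≤r)) *⁺ (0≤p +⁺ (0≤q +⁺ (0≤r +⁺ 0≤s)))))
             (y≤x+y 0≤t)
             (*-mono-≤ (0≤q +⁺ 0≤r) ((0≤p +⁺ (0≤q +⁺ 0≤r)) *⁺ (0≤p +⁺ (0≤q +⁺ (0≤r +⁺ 0≤s))))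
               (≈+⇒≤ (solve 3 (λ q r t → t :+ r :+ q := q :+ r :+ t) refl q r t) 0≤t)
               (*-monoʳ-≤ (0≤p +⁺ (0≤q +⁺ 0≤r))
                 (≤-trans (y≤x+y 0≤r) (≤-trans (y≤x+y 0≤q) (y≤x+y 0≤p))))) ⟩
      p * ((p + q) * ((p + (q + r)) * (p + (q + (r + s))))) ∎
      where open PosetReasoning poset

    b₄≤b₅ : b₄ ≤ b₅
    b₄≤b₅ = *-mono-≤ (0≤p +⁺ (0≤q +⁺ 0≤r))
      ((0≤q +⁺ (0≤r +⁺ 0≤s)) *⁺ ((0≤r +⁺ 0≤s) *⁺ 0≤s))
      (+-mono-≤ ≤-refl (+-mono-≤ ≤-refl r≤r+s))
      (*-mono-≤ (0≤q +⁺ 0≤r) ((0≤r +⁺ 0≤s) *⁺ 0≤s) (+-mono-≤ ≤-refl r≤r+s)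
        (*-mono-≤ 0≤r 0≤s r≤r+s ≤-refl))
      where
      r≤r+s : r ≤ r + s
      r≤r+s = ≈+⇒≤ refl 0≤s

    -- The difference is linear in `s`. With `m = p + q + r`, its coefficient at `s` is
    -- `t * (m * m - q * q)`, where `m - q = p + r`. In the part free of `s`, `b₄` vanishes, `b₃`
    -- gives `(p + q) * (q * (r * r))`, and `b₁ - b₂` gives `p * (p * (m * m) + q * (m * m - (q + r)
    -- * (q + r)))`, where `m - (q + r) = p`.
    b₂+b₄≤b₁+b₃ : b₂ + b₄ ≤ b₁ + b₃
    b₂+b₄≤b₁+b₃ = ≈+⇒≤
      (solve 4 (λ q r s t → let p = t :+ r ; m = p :+ q :+ r in
         p :* ((p :+ q) :* ((p :+ (q :+ r)) :* (p :+ (q :+ (r :+ s)))))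
         :+ (p :+ q) :* (q :* (r :* (r :+ s)))
         :=
         (p :* (q :* ((q :+ r) :* (q :+ (r :+ s))))
         :+ (p :+ (q :+ r)) :* ((q :+ r) :* (r :* s)))
         :+ (s :* (t :* ((p :+ r) :* (m :+ q)))
             :+ (p :+ q) :* (q :* (r :* r))
             :+ p :* (p :* (m :* m) :+ q :* (p :* (m :+ q :+ r)))))
         refl q r s t)
      (0≤s *⁺ (0≤t *⁺ ((0≤p +⁺ 0≤r) *⁺ (0≤m +⁺ 0≤q)))
       +⁺ (0≤p +⁺ 0≤q) *⁺ (0≤q *⁺ (0≤r *⁺ 0≤r))
       +⁺ 0≤p *⁺ (0≤p *⁺ (0≤m *⁺ 0≤m) +⁺ 0≤q *⁺ (0≤p *⁺ (0≤m +⁺ 0≤q +⁺ 0≤r))))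
      where
      0≤m : 0# ≤ p + q + r
      0≤m = 0≤p +⁺ 0≤q +⁺ 0≤r

  -- The five points and their differences.

  telescope : x - y ≈ d → y - z ≈ e → x - z ≈ d + e
  telescope {x} {y} {d} {z} {e} x-y≈d y-z≈e = begin
    x - z              ≈⟨ +-congʳ (//-rightDividesˡ y x) ⟨
    (x - y) + y - z    ≈⟨ +-assoc (x - y) y (- z) ⟩
    (x - y) + (y - z)  ≈⟨ +-cong x-y≈d y-z≈e ⟩
    d + e              ∎
    where open SetoidReasoning setoid

  reverse : x - y ≈ d → y - x ≈ - d
  reverse {x} {y} x-y≈d =
    trans (sym (⁻¹-anti-homo‿- x y)) (-‿cong x-y≈d)

  ≤+⇒-≤- : y + z ≤ x + w → z - w ≤ x - y
  ≤+⇒-≤- {y} {z} {x} {w} y+z≤x+w = +-cancelʳ-≤ (y + w) (begin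
    (z - w) + (y + w)  ≈⟨ solve 4 (λ z w′ y w → (z :+ w′) :+ (y :+ w) := (z :+ w′ :+ w) :+ y) refl z (- w) y w ⟩
    (z - w) + w + y    ≈⟨ +-congʳ (//-rightDividesˡ w z) ⟩
    z + y              ≈⟨ +-comm z y ⟩
    y + z              ≤⟨ y+z≤x+w ⟩
    x + w              ≈⟨ +-congʳ (//-rightDividesˡ y x) ⟨
    (x - y) + y + w    ≈⟨ +-assoc (x - y) y w ⟩
    (x - y) + (y + w)  ∎)
    where open PosetReasoning poset

  -- The factor 1# comes from the definition of product.
  *-cong₄ : ∀ {x₁ x₂ x₃ x₄ y₁ y₂ y₃ y₄ : Carrier} →
            x₁ ≈ y₁ → x₂ ≈ y₂ → x₃ ≈ y₃ → x₄ ≈ y₄ →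
            x₁ * (x₂ * (x₃ * (x₄ * 1#))) ≈ y₁ * (y₂ * (y₃ * y₄))
  *-cong₄ e₁ e₂ e₃ e₄ = *-cong e₁ (*-cong e₂ (*-cong e₃ (trans (*-identityʳ _) e₄)))

  -x*[-y*z]≈x*[y*z] : ∀ x y z → - x * (- y * z) ≈ x * (y * z)
  -x*[-y*z]≈x*[y*z] x y z = trans (*-congˡ (sym (-‿distribˡ-* y z))) (-x*-y≈x*y x (y * z))

  module FivePoints
    (x : Vector Carrier 5)
    (x-decreasing : ∀ (i : Fin 4) → x (inject₁ i) ≥ x (suc i))
    (x₂+x₃≤x₁+x₄ : x 0F + x 3F ≥ x 1F + x 2F) where

    q r s t : Carrier
    q = x 1F - x 2F
    r = x 2F - x 3F
    s = x 3F - x 4F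
    t = (x 0F - x 1F) - r

    open GapPolynomials {q} {r} {s} {t} (≤⇒0≤- (x-decreasing 1F)) (≤⇒0≤- (x-decreasing 2F))
      (≤⇒0≤- (x-decreasing 3F)) (≤⇒0≤- (≤+⇒-≤- x₂+x₃≤x₁+x₄)) public

    -- The subscripts count the points from 1. Sums of gaps are bracketed as in the factors of the
    -- `bᵢ`, so that only signs remain to be matched.
    d₁₂ : x 0F - x 1F ≈ p
    d₁₂ = sym (//-rightDividesˡ r (x 0F - x 1F))

    d₂₄ : x 1F - x 3F ≈ q + r
    d₂₄ = telescope refl refl

    d₃₅ : x 2F - x 4F ≈ r + s
    d₃₅ = telescope refl refl

    d₂₅ : x 1F - x 4F ≈ q + (r + s)
    d₂₅ = telescope refl d₃₅

    d₁₃ : x 0F - x 2F ≈ p + q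
    d₁₃ = telescope d₁₂ refl

    d₁₄ : x 0F - x 3F ≈ p + (q + r)
    d₁₄ = telescope d₁₂ d₂₄

    d₁₅ : x 0F - x 4F ≈ p + (q + (r + s))
    d₁₅ = telescope d₁₂ d₂₅

    power : ∀ n i → product (λ j → x i - removeAt x i j) ≈ d → ∏-differences x n i ≈ d ^ n
    power n i eq = trans (product-^ (λ j → x i - removeAt x i j) n) (^-congˡ n eq)

    -- The i-th point is preceded by i - 1 others, so its product carries i - 1 minus signs. They
    -- cancel in pairs, leaving one for the second and the fourth point.
    ∏₁≈ : ∀ n → ∏-differences x n 0F ≈ b₁ ^ n
    ∏₁≈ n = power n 0F (*-cong₄ d₁₂ d₁₃ d₁₄ d₁₅)

    ∏₂≈ : ∀ n → ∏-differences x n 1F ≈ (- b₂) ^ n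
    ∏₂≈ n = power n 1F (trans (*-cong₄ (reverse d₁₂) refl d₂₄ d₂₅) (sym (-‿distribˡ-* _ _)))

    ∏₃≈ : ∀ n → ∏-differences x n 2F ≈ b₃ ^ n
    ∏₃≈ n = power n 2F
      (trans (*-cong₄ (reverse d₁₃) (reverse refl) refl d₃₅) (-x*[-y*z]≈x*[y*z] _ _ _))

    ∏₄≈ : ∀ n → ∏-differences x n 3F ≈ (- b₄) ^ n
    ∏₄≈ n = power n 3F (begin
      product (λ j → x 3F - removeAt x 3F j)
        ≈⟨ *-cong₄ (reverse d₁₄) (reverse d₂₄) (reverse refl) refl ⟩
      - (p + (q + r)) * (- (q + r) * (- r * s))  ≈⟨ -x*[-y*z]≈x*[y*z] _ _ _ ⟩
      (p + (q + r)) * ((q + r) * (- r * s))      ≈⟨ *-congˡ (*-congˡ (-‿distribˡ-* r s)) ⟨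
      (p + (q + r)) * ((q + r) * - (r * s))      ≈⟨ *-congˡ (-‿distribʳ-* _ _) ⟨
      (p + (q + r)) * - ((q + r) * (r * s))      ≈⟨ -‿distribʳ-* _ _ ⟨
      - b₄                                       ∎)
      where open SetoidReasoning setoid

    ∏₅≈ : ∀ n → ∏-differences x n 4F ≈ b₅ ^ n
    ∏₅≈ n = power n 4F
      (trans (*-cong₄ (reverse d₁₅) (reverse d₂₅) (reverse d₃₅) (reverse refl))
        (trans (-x*[-y*z]≈x*[y*z] _ _ _) (*-congˡ (*-congˡ (-x*-y≈x*y _ _)))))

theorem12 : ∀ {c ℓ₁ ℓ₂} (I : PartiallyOrderedCommutativeRing c ℓ₁ ℓ₂) →
    let open PartiallyOrderedCommutativeRing I in
    (x : Vector Carrier 5) →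
    (∀ (i : Fin 4) → x (inject₁ i) ≥ x (suc i)) →
    x 0F + x 3F ≥ x 1F + x 2F →
    (n : ℕ) →
    (a : Vector Carrier 5) →
    (â₂ â₄ : Carrier) →
    IsUpperBound ｛ a 1F , - a 1F ｝ â₂ →
    IsUpperBound ｛ a 3F , - a 3F ｝ â₄ →
    a 0F ≥ â₂ → â₂ ≥ a 2F → a 2F ≥ 0# →
    (a 2F + a 4F ≥ â₄ × â₄ ≥ a 4F × a 4F ≥ 0#) ⊎ (a 4F ≥ â₄ × â₄ ≥ 0#) →
    sum (λ i → a i * ∏-differences x n i) ≥ 0#
theorem12 I x x-decreasing x₂+x₃≤x₁+x₄ n a _ _ ∣a₂∣≤â₂ ∣a₄∣≤â₄ â₂≤a₁ a₃≤â₂ 0≤a₃ cases =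
  signed-sum-nonNegative n ∣a₂∣≤â₂ ∣a₄∣≤â₄ â₂≤a₁ a₃≤â₂ 0≤a₃ cases
    0≤b₃ b₃≤b₂ b₂≤b₁ 0≤b₄ b₄≤b₁ b₂+b₄≤b₁+b₃ b₄≤b₅
    (∏₁≈ n) (∏₂≈ n) (∏₃≈ n) (∏₄≈ n) (∏₅≈ n)
  where
  open OrderedRingProperties I
  open FivePoints x x-decreasing x₂+x₃≤x₁+x₄
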